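{- Let $\Omega$ be a topological signature, $X$ a topological space, and $\mathcal B$ a Boolean subalgebra of $\mathcal P(T_\Omega(X))$ satisfying condition $(\ast)$. For $w\in\Omega_n$ and ultrafilters $U_1,\dots,U_n$ of $\mathcal B$, let $w(U_1,\dots,U_n)$ be the set of all $L\in\mathcal B$ for which there are $L_i\in U_i$ ($i=1,\dots,n$) with $w(L_1,\dots,L_n)\subseteq L$ (here $w(L_1,\dots,L_n)=\{w(t_1,\dots,t_n):t_i\in L_i\}$). Then each $w(U_1,\dots,U_n)$ is an ultrafilter of $\mathcal B$, and the evaluation maps $(w,U_1,\dots,U_n)\mapsto w(U_1,\dots,U_n)$ make the Stone dual space $\mathcal B^\star$ a Stone topological $\Omega$-algebra. Moreover, if every $L\in\mathcal B$ is such that $L\cap X$ is open in $X$, then the map $X\to\mathcal B^\star$, $x\mapsto U_x=\{L\in\mathcal B:x\in L\}$, is a generating mapping.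
   Context: $T_\Omega(X)$ is the term algebra on $X$: finite ordered trees with leaves labeled in $X\uplus\Omega_0$ and nodes with $k$ children labeled in $\Omega_k$, topologized as the topological sum over tree shapes of products of label spaces; $X$ is identified with single-node trees; $E_n:\Omega_n\times T_\Omega(X)^n\to T_\Omega(X)$ is its evaluation map. $\mathcal P(S)$ is the Boolean algebra of all subsets of $S$, and $\mathcal P_{co}(S)$ that of clopen subsets of a space $S$. For a Boolean subalgebra $\mathcal B$ of $\mathcal P(T_\Omega(X))$, let $\mathcal B'_n$ be the Boolean subalgebra of $\mathcal P(\Omega_n\times T_\Omega(X)^n)$ generated by all sets $K\times L_1\times\cdots\times L_n$ with $K$ clopen in $\Omega_n$ and $L_i\in\mathcal B$. Condition $(\ast)$: for every $n$ and every $L\in\mathcal B$, $E_n^{ -1}(L)\in\mathcal B'_n$. $\mathcal B^\star$ is the set of ultrafilters of $\mathcal B$ with basic open sets $\{U: L\in U\}$, $L\in\mathcal B$. A Stone topological algebra is a compact Hausdorff 0-dimensional space with continuous evaluation maps $\Omega_n\times A^n\to A$. A generating mapping is a continuous map $X\to A$ whose image generates a dense subalgebra of $A$. -}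

module Defs where

open import Data.Empty.Polymorphic using (⊥)
open import Data.Fin.Base using (Fin)
open import Data.List.Base using (List)
open import Data.List.Relation.Unary.All using (All)
open import Data.List.Relation.Unary.Any using (Any)
open import Data.Nat.Base using (ℕ)
open import Data.Product.Base using (Σ-syntax; ∃; ∃₂; _×_; _,_; proj₁; proj₂)
open import Data.Product.Relation.Binary.Pointwise.NonDependent using (×-setoid)
open import Data.Sum.Base using (_⊎_)
open import Data.Unit.Polymorphic using (⊤; tt)
open import Level using (Level; suc; _⊔_)
open import Relation.Binary.Bundles using (Setoid)
open import Relation.Binary.Core using (Rel)
open import Relation.Binary.Definitions using (_Respects_)
open import Relation.Nullary.Negation.Core using (¬_)
open import Relation.Unary using (Pred; _∈_; _⊆_; _≐_; ∁; _∩_; _∪_; _⟨×⟩_; _⊢_)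
import Relation.Unary as Unary

private
  variable
    a b c ℓ : Level

------------------------------------------------------------------------
-- Subsets

Empty Full : {A : Set a} → Pred A ℓ
Empty _ = ⊥
Full  _ = ⊤

Union : {A : Set a} → Pred (Pred A b) c → Pred A (a ⊔ suc b ⊔ c)
Union 𝒰 x = ∃ λ U → U ∈ 𝒰 × x ∈ U

Box : ∀ {n} {A : Fin n → Set a} → (∀ i → Pred (A i) ℓ) → Pred (∀ i → A i) ℓ
Box P f = ∀ i → f i ∈ P i

------------------------------------------------------------------------
-- Topological spaces

-- Points are compared with a setoid equality (Agda has no quotient
-- types), which open sets have to respect.  In Open-⋃ the set W is
-- only required to have the same elements as ⋃ 𝒰, because ⋃ 𝒰 itself
-- lives in a larger universe than the subsets W.

record Space (a : Level) : Set (suc (suc a)) where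
  field
    setoid : Setoid a a
  open Setoid setoid public using (Carrier; _≈_)
  field
    Open      : Pred (Pred Carrier a) (suc a)
    Open-resp : ∀ {U} → Open U → U Respects _≈_
    Open-Full : Open Full
    Open-∩    : ∀ {U V} → Open U → Open V → Open (U ∩ V)
    Open-⋃    : (𝒰 : Pred (Pred Carrier a) (suc a)) → 𝒰 ⊆ Open →
                ∀ {W} → W ≐ Union 𝒰 → Open W

  Clopen : Pred (Pred Carrier a) (suc a)
  Clopen U = Open U × Open (∁ U)

  -- Openness for subsets in an arbitrary universe.
  IsOpen : Pred (Pred Carrier ℓ) (suc a ⊔ ℓ)
  IsOpen W = ∃ λ U → U ∈ Open × U ≐ W

record IsBase (S : Setoid a a) (𝒢 : Pred (Pred (Setoid.Carrier S) a) b) :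
              Set (suc a ⊔ b) where
  open Setoid S using (Carrier; _≈_)
  field
    𝒢-resp  : ∀ {U} → U ∈ 𝒢 → U Respects _≈_
    𝒢-cover : ∀ x → ∃ λ U → U ∈ 𝒢 × x ∈ U
    𝒢-∩     : ∀ {U V} → U ∈ 𝒢 → V ∈ 𝒢 → (U ∩ V) ∈ 𝒢

  -- Opens W holds iff W is a union of members of 𝒢.
  Opens : Pred (Pred Carrier a) (suc a ⊔ b)
  Opens W = ∀ {x} → x ∈ W → ∃ λ U → U ∈ 𝒢 × x ∈ U × U ⊆ W

  Opens-resp : ∀ {U} → Opens U → U Respects _≈_
  Opens-resp o x≈y x∈U with o x∈U
  ... | V , V∈𝒢 , x∈V , V⊆U = V⊆U (𝒢-resp V∈𝒢 x≈y x∈V)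

  Opens-Full : Opens Full
  Opens-Full {x} _ with 𝒢-cover x
  ... | V , V∈𝒢 , x∈V = V , V∈𝒢 , x∈V , λ _ → tt

  Opens-∩ : ∀ {U V} → Opens U → Opens V → Opens (U ∩ V)
  Opens-∩ o o′ (x∈U , x∈V) with o x∈U | o′ x∈V
  ... | P , P∈𝒢 , x∈P , P⊆U | Q , Q∈𝒢 , x∈Q , Q⊆V =
    (P ∩ Q) , 𝒢-∩ P∈𝒢 Q∈𝒢 , (x∈P , x∈Q) ,
    λ (y∈P , y∈Q) → P⊆U y∈P , Q⊆V y∈Q

  Opens-⋃ : (𝒰 : Pred (Pred Carrier a) c) → 𝒰 ⊆ Opens →
            ∀ {W} → W ≐ Union 𝒰 → Opens W
  Opens-⋃ 𝒰 𝒰⊆ (W⊆ , ⊆W) x∈W with W⊆ x∈W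
  ... | U , U∈𝒰 , x∈U with 𝒰⊆ U∈𝒰 x∈U
  ...   | V , V∈𝒢 , x∈V , V⊆U =
    V , V∈𝒢 , x∈V , λ y∈V → ⊆W (U , U∈𝒰 , V⊆U y∈V)

module _ (A : Space a) (B : Space b) where
  private
    module A = Space A
    module B = Space B

    S : Setoid (a ⊔ b) (a ⊔ b)
    S = ×-setoid A.setoid B.setoid

    Rect : Pred (Pred (Setoid.Carrier S) (a ⊔ b)) (suc (a ⊔ b))
    Rect W = ∃₂ λ U V → A.Open U × B.Open V × W ≐ (U ⟨×⟩ V)

    Rect-isBase : IsBase S Rect
    Rect-isBase = record
      { 𝒢-resp = λ (U , V , oU , oV , W⊆ , ⊆W) (x≈ , y≈) p →
          ⊆W (A.Open-resp oU x≈ (proj₁ (W⊆ p)) , B.Open-resp oV y≈ (proj₂ (W⊆ p)))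
      ; 𝒢-cover = λ _ → (Full ⟨×⟩ Full) ,
          (Full , Full , A.Open-Full , B.Open-Full , (λ p → p) , (λ p → p)) ,
          tt , tt
      ; 𝒢-∩ = λ (U , V , oU , oV , W⊆ , ⊆W) (U′ , V′ , oU′ , oV′ , W′⊆ , ⊆W′) →
          (U ∩ U′) , (V ∩ V′) , A.Open-∩ oU oU′ , B.Open-∩ oV oV′ ,
          (λ (p , q) → (proj₁ (W⊆ p) , proj₁ (W′⊆ q)) ,
                       (proj₂ (W⊆ p) , proj₂ (W′⊆ q))) ,
          (λ ((u , u′) , (v , v′)) → ⊆W (u , v) , ⊆W′ (u′ , v′))
      }

    module R = IsBase Rect-isBase

  infixr 2 _×ₛ_

  _×ₛ_ : Space (a ⊔ b)
  _×ₛ_ = record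
    { setoid    = S
    ; Open      = R.Opens
    ; Open-resp = R.Opens-resp
    ; Open-Full = R.Opens-Full
    ; Open-∩    = R.Opens-∩
    ; Open-⋃    = R.Opens-⋃
    }

module _ {n : ℕ} (A : Fin n → Space a) where
  private
    module A i = Space (A i)
    module S i = Setoid (A.setoid i)

    S : Setoid a a
    S = record
      { Carrier       = ∀ i → A.Carrier i
      ; _≈_           = λ f g → ∀ i → S._≈_ i (f i) (g i)
      ; isEquivalence = record
        { refl  = λ i → S.refl i
        ; sym   = λ p i → S.sym i (p i)
        ; trans = λ p q i → S.trans i (p i) (q i)
        }
      }

    Boxes : Pred (Pred (∀ i → A.Carrier i) a) (suc a)
    Boxes W = Σ[ U ∈ (∀ i → Pred (A.Carrier i) a) ]
              (∀ i → A.Open i (U i)) × W ≐ Box U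

    Boxes-isBase : IsBase S Boxes
    Boxes-isBase = record
      { 𝒢-resp = λ (U , o , W⊆ , ⊆W) f≈g f∈W →
          ⊆W (λ i → A.Open-resp i (o i) (f≈g i) (W⊆ f∈W i))
      ; 𝒢-cover = λ _ → Box {A = A.Carrier} (λ _ → Full) ,
          ((λ _ → Full) , (λ i → A.Open-Full i) , (λ p → p) , (λ p → p)) ,
          λ _ → tt
      ; 𝒢-∩ = λ (U , o , W⊆ , ⊆W) (U′ , o′ , W′⊆ , ⊆W′) →
          (λ i → U i ∩ U′ i) , (λ i → A.Open-∩ i (o i) (o′ i)) ,
          (λ (p , q) i → W⊆ p i , W′⊆ q i) ,
          (λ p → ⊆W (λ i → proj₁ (p i)) , ⊆W′ (λ i → proj₂ (p i)))
      }

    module R = IsBase Boxes-isBase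

  Πₛ : Space a
  Πₛ = record
    { setoid    = S
    ; Open      = R.Opens
    ; Open-resp = R.Opens-resp
    ; Open-Full = R.Opens-Full
    ; Open-∩    = R.Opens-∩
    ; Open-⋃    = R.Opens-⋃
    }

infixl 8 _^ₛ_

_^ₛ_ : Space a → ℕ → Space a
A ^ₛ n = Πₛ {n = n} (λ _ → A)

record Continuous (A : Space a) (B : Space b)
                  (f : Space.Carrier A → Space.Carrier B) : Set (suc (a ⊔ b)) where
  private
    module A = Space A
    module B = Space B
  field
    cong     : ∀ {x y} → x A.≈ y → f x B.≈ f y
    preimage : ∀ {V} → B.Open V → A.IsOpen (f ⊢ V)

module _ (A : Space a) where
  open Space A

  Compact : Set (suc (suc a))
  Compact = (𝒰 : Pred (Pred Carrier a) (suc a)) → 𝒰 ⊆ Open →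
            (∀ x → x ∈ Union 𝒰) →
            Σ[ Us ∈ List (Pred Carrier a) ]
              All (_∈ 𝒰) Us × (∀ x → Any (x ∈_) Us)

  Hausdorff : Set (suc a)
  Hausdorff = ∀ x y → ¬ x ≈ y →
              ∃₂ λ U V → Open U × Open V × x ∈ U × y ∈ V × U Unary.⊥ V

  ZeroDimensional : Set (suc a)
  ZeroDimensional = ∀ {W} → Open W → ∀ {x} → x ∈ W →
                    ∃ λ C → Clopen C × x ∈ C × C ⊆ W

  Dense : Pred Carrier ℓ → Set (suc a ⊔ ℓ)
  Dense D = ∀ {W} → Open W → ∀ {x} → x ∈ W → ∃ λ y → y ∈ D × y ∈ W

------------------------------------------------------------------------
-- Boolean subalgebras of 𝒫(S)

-- The elements of 𝒫(S) are the predicates respecting the equality of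
-- S, taken up to _≐_.

module _ (S : Setoid a a) where
  open Setoid S using (Carrier; _≈_)

  record IsBooleanSubalgebra (ℬ : Pred (Pred Carrier a) b) : Set (suc a ⊔ b) where
    field
      subset   : ∀ {L} → L ∈ ℬ → L Respects _≈_
      resp-≐   : ∀ {L M} → L ≐ M → L ∈ ℬ → M ∈ ℬ
      Empty∈   : Empty ∈ ℬ
      Full∈    : Full ∈ ℬ
      ∁-closed : ∀ {L} → L ∈ ℬ → ∁ L ∈ ℬ
      ∩-closed : ∀ {L M} → L ∈ ℬ → M ∈ ℬ → (L ∩ M) ∈ ℬ
      ∪-closed : ∀ {L M} → L ∈ ℬ → M ∈ ℬ → (L ∪ M) ∈ ℬ

  data BooleanClosure (𝒢 : Pred (Pred Carrier a) b) :
                      Pred (Pred Carrier a) (suc a ⊔ b) where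
    generator : ∀ {L} → L ∈ 𝒢 → BooleanClosure 𝒢 L
    same      : ∀ {L M} → L ≐ M → BooleanClosure 𝒢 L → BooleanClosure 𝒢 M
    empty     : BooleanClosure 𝒢 Empty
    full      : BooleanClosure 𝒢 Full
    compl     : ∀ {L} → BooleanClosure 𝒢 L → BooleanClosure 𝒢 (∁ L)
    inter     : ∀ {L M} → BooleanClosure 𝒢 L → BooleanClosure 𝒢 M →
                BooleanClosure 𝒢 (L ∩ M)
    union     : ∀ {L M} → BooleanClosure 𝒢 L → BooleanClosure 𝒢 M →
                BooleanClosure 𝒢 (L ∪ M)

  record IsUltrafilter (ℬ : Pred (Pred Carrier a) (suc a))
                       (𝒰 : Pred (Pred Carrier a) (suc a)) : Set (suc a) where
    field
      ⊆ℬ       : 𝒰 ⊆ ℬ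
      Full∈    : Full ∈ 𝒰
      Empty∉   : ¬ Empty ∈ 𝒰
      upward   : ∀ {L M} → L ∈ 𝒰 → M ∈ ℬ → L ⊆ M → M ∈ 𝒰
      ∩-closed : ∀ {L M} → L ∈ 𝒰 → M ∈ 𝒰 → (L ∩ M) ∈ 𝒰
      ultra    : ∀ {L} → L ∈ ℬ → L ∈ 𝒰 ⊎ ∁ L ∈ 𝒰

  Ultrafilter : Pred (Pred Carrier a) (suc a) → Set (suc (suc a))
  Ultrafilter ℬ = Σ[ 𝒰 ∈ Pred (Pred Carrier a) (suc a) ] IsUltrafilter ℬ 𝒰

------------------------------------------------------------------------
-- Stone dual of a Boolean algebra of subsets

module _ {S : Setoid a a} (ℬ : Pred (Pred (Setoid.Carrier S) a) (suc a))
         (isBA : IsBooleanSubalgebra S ℬ) where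
  private
    module ℬ = IsBooleanSubalgebra isBA
    module UF (u : Ultrafilter S ℬ) = IsUltrafilter (proj₂ u)

    D : Setoid (suc (suc a)) (suc (suc a))
    D = record
      { Carrier       = Ultrafilter S ℬ
      ; _≈_           = λ u v → Level.Lift (suc (suc a)) (proj₁ u ≐ proj₁ v)
      ; isEquivalence = record
        { refl  = Level.lift ((λ p → p) , (λ p → p))
        ; sym   = λ (Level.lift (p , q)) → Level.lift (q , p)
        ; trans = λ (Level.lift (p , q)) (Level.lift (p′ , q′)) →
                  Level.lift ((λ x → p′ (p x)) , (λ x → q (q′ x)))
        }
      }

    BasicOpen : Pred (Pred (Ultrafilter S ℬ) (suc (suc a))) (suc (suc a))
    BasicOpen W = ∃ λ L → L ∈ ℬ × W ≐ (λ u → L ∈ proj₁ u)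

    BasicOpen-isBase : IsBase D BasicOpen
    BasicOpen-isBase = record
      { 𝒢-resp = λ (L , L∈ℬ , W⊆ , ⊆W) (Level.lift (p , _)) x → ⊆W (p (W⊆ x))
      ; 𝒢-cover = λ u →
          Full , (Full , ℬ.Full∈ , (λ {v} _ → UF.Full∈ v) , (λ _ → tt)) , tt
      ; 𝒢-∩ = λ (L , L∈ℬ , W⊆ , ⊆W) (M , M∈ℬ , W′⊆ , ⊆W′) →
          (L ∩ M) , ℬ.∩-closed L∈ℬ M∈ℬ ,
          (λ {u} (p , q) → UF.∩-closed u (W⊆ p) (W′⊆ q)) ,
          (λ {u} p → ⊆W (UF.upward u p L∈ℬ proj₁) , ⊆W′ (UF.upward u p M∈ℬ proj₂))
      }

    module R = IsBase BasicOpen-isBase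

  StoneDual : Space (suc (suc a))
  StoneDual = record
    { setoid    = D
    ; Open      = R.Opens
    ; Open-resp = R.Opens-resp
    ; Open-Full = R.Opens-Full
    ; Open-∩    = R.Opens-∩
    ; Open-⋃    = R.Opens-⋃
    }

------------------------------------------------------------------------
-- Topological signatures and algebras

TopologicalSignature : (a : Level) → Set (suc (suc a))
TopologicalSignature a = ℕ → Space a

module _ (Ω : TopologicalSignature a) where

  -- Domain of the n-th evaluation map.
  Dom : Space b → ℕ → Space (a ⊔ b)
  Dom A n = Ω n ×ₛ A ^ₛ n

  Evaluation : Space b → Set (a ⊔ b)
  Evaluation A = ∀ n → Space.Carrier (Dom A n) → Space.Carrier A

  record IsStoneTopologicalAlgebra (A : Space b) (E : Evaluation A) :
                                   Set (suc a ⊔ suc (suc b)) where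
    field
      compact         : Compact A
      hausdorff       : Hausdorff A
      zeroDimensional : ZeroDimensional A
      continuous      : ∀ n → Continuous (Dom A n) A (E n)

  data Subalgebra (A : Space b) (E : Evaluation A) (G : Pred (Space.Carrier A) ℓ) :
                  Pred (Space.Carrier A) (a ⊔ b ⊔ ℓ) where
    generator : ∀ {x} → x ∈ G → Subalgebra A E G x
    resp-≈    : ∀ {x y} → Space._≈_ A x y → Subalgebra A E G x → Subalgebra A E G y
    closed    : ∀ {n} w xs → (∀ i → Subalgebra A E G (xs i)) →
                Subalgebra A E G (E n (w , xs))

  record IsGeneratingMapping (X : Space c) (A : Space b) (E : Evaluation A)
                             (f : Space.Carrier X → Space.Carrier A) :
                             Set (suc (a ⊔ b ⊔ c)) where
    field
      continuous : Continuous X A f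
      dense      : Dense A (Subalgebra A E (λ y → ∃ λ x → Space._≈_ A y (f x)))

------------------------------------------------------------------------
-- The term algebra

  module _ (X : Space a) where
    private
      module Ω n = Space (Ω n)
      module ΩS n = Setoid (Ω.setoid n)
      module X = Space X
      module XS = Setoid X.setoid

    data Term : Set a where
      var : X.Carrier → Term
      op  : ∀ {n} → Ω.Carrier n → (Fin n → Term) → Term

    infix 4 _≈ₜ_

    data _≈ₜ_ : Rel Term a where
      var : ∀ {x y} → x X.≈ y → var x ≈ₜ var y
      op  : ∀ {n} {v w} {ss ts : Fin n → Term} →
            Ω._≈_ n v w → (∀ i → ss i ≈ₜ ts i) → op v ss ≈ₜ op w ts

    private
      ≈ₜ-refl : ∀ t → t ≈ₜ t
      ≈ₜ-refl (var x)      = var XS.refl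
      ≈ₜ-refl (op {n} w ts) = op (ΩS.refl n) (λ i → ≈ₜ-refl (ts i))

      ≈ₜ-sym : ∀ {s t} → s ≈ₜ t → t ≈ₜ s
      ≈ₜ-sym (var p)        = var (XS.sym p)
      ≈ₜ-sym (op {n} p ps)  = op (ΩS.sym n p) (λ i → ≈ₜ-sym (ps i))

      ≈ₜ-trans : ∀ {s t u} → s ≈ₜ t → t ≈ₜ u → s ≈ₜ u
      ≈ₜ-trans (var p)       (var q)     = var (XS.trans p q)
      ≈ₜ-trans (op {n} p ps) (op q qs)   =
        op (ΩS.trans n p q) (λ i → ≈ₜ-trans (ps i) (qs i))

    Term-setoid : Setoid a a
    Term-setoid = record
      { Carrier       = Term
      ; _≈_           = _≈ₜ_
      ; isEquivalence = record
        { refl = λ {t} → ≈ₜ-refl t ; sym = ≈ₜ-sym ; trans = ≈ₜ-trans }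
      }

    data Shape : Set where
      leaf : Shape
      node : ∀ {n} → (Fin n → Shape) → Shape

    Labels : Shape → Space a
    Labels leaf          = X
    Labels (node {n} ss) = Ω n ×ₛ Πₛ (λ i → Labels (ss i))

    tree : ∀ s → Space.Carrier (Labels s) → Term
    tree leaf      x        = var x
    tree (node ss) (w , ls) = op w (λ i → tree (ss i) (ls i))

    -- The topological sum over all shapes s of the spaces Labels s: a
    -- set of terms is open iff its trace on every summand is open.
    TermAlgebra : Space a
    TermAlgebra = record
      { setoid    = Term-setoid
      ; Open      = λ W → W Respects _≈ₜ_ × (∀ s → Space.Open (Labels s) (tree s ⊢ W))
      ; Open-resp = proj₁
      ; Open-Full = (λ _ _ → tt) , λ s → Space.Open-Full (Labels s)
      ; Open-∩    = λ (r , o) (r′ , o′) →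
          (λ x≈y (p , q) → r x≈y p , r′ x≈y q) ,
          (λ s → Space.Open-∩ (Labels s) (o s) (o′ s))
      ; Open-⋃    = λ 𝒰 𝒰⊆ (W⊆ , ⊆W) →
          (λ x≈y p → let (U , U∈𝒰 , x∈U) = W⊆ p in
                     ⊆W (U , U∈𝒰 , proj₁ (𝒰⊆ U∈𝒰) x≈y x∈U)) ,
          (λ s → Space.Open-⋃ (Labels s)
            (λ V → Σ[ U ∈ Pred Term a ] U ∈ 𝒰 × V ≐ (tree s ⊢ U))
            (λ {V} (U , U∈𝒰 , V≐) → open-resp-≐ (Labels s) V≐ (proj₂ (𝒰⊆ U∈𝒰) s))
            ( (λ p → let (U , U∈𝒰 , x∈U) = W⊆ p in
                     tree s ⊢ U , (U , U∈𝒰 , (λ q → q) , (λ q → q)) , x∈U)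
            , (λ (V , (U , U∈𝒰 , V⊆ , _) , x∈V) → ⊆W (U , U∈𝒰 , V⊆ x∈V))))
      }
      where
      open-resp-≐ : (A : Space a) → ∀ {V U} → V ≐ U → Space.Open A U → Space.Open A V
      open-resp-≐ A {V} {U} (V⊆ , ⊆V) oU =
        Space.Open-⋃ A (λ P → Space.Open A P × P ≐ U) proj₁
          ( (λ p → U , (oU , (λ q → q) , (λ q → q)) , V⊆ p)
          , (λ (P , (_ , P⊆ , _) , p) → ⊆V (P⊆ p)))

    termEval : Evaluation TermAlgebra
    termEval n (w , ts) = op w ts

------------------------------------------------------------------------
-- Condition (∗) and the operations on ultrafilters

    module _ (ℬ : Pred (Pred Term a) (suc a)) where

      Product : ∀ n → Pred (Pred (Space.Carrier (Dom TermAlgebra n)) a) (suc a)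
      Product n W = ∃₂ λ (K : Pred (Ω.Carrier n) a) (L : Fin n → Pred Term a) →
                    Ω.Clopen n K × (∀ i → L i ∈ ℬ) × W ≐ (K ⟨×⟩ Box L)

      ℬ′ : ∀ n → Pred (Pred (Space.Carrier (Dom TermAlgebra n)) a) (suc a)
      ℬ′ n = BooleanClosure (Space.setoid (Dom TermAlgebra n)) (Product n)

      Condition-∗ : Set (suc a)
      Condition-∗ = ∀ n {L} → L ∈ ℬ → (termEval n ⊢ L) ∈ ℬ′ n

      image : ∀ {n} → Ω.Carrier n → (Fin n → Pred Term a) → Pred Term a
      image {n} w L t = ∃ λ ts → ts ∈ Box L × t ≈ₜ termEval n (w , ts)

      apply : ∀ {n} → Ω.Carrier n → (Fin n → Ultrafilter Term-setoid ℬ) →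
              Pred (Pred Term a) (suc a)
      apply w u L = L ∈ ℬ × ∃ λ Ls → (∀ i → Ls i ∈ proj₁ (u i)) × image w Ls ⊆ L

      principal : X.Carrier → Pred (Pred Term a) (suc a)
      principal x L = L ∈ ℬ × var x ∈ L

{-# OPTIONS --safe #-}
module Submission where

-- The key point is that every W ∈ ℬ′ₙ is constant near every point (w , u)
-- of Ωₙ × (ℬ⋆)ⁿ: there are an open K ∋ w and Lᵢ ∈ uᵢ such that K × L₁ × ⋯ × Lₙ
-- is contained in W or in its complement.  Applied to W = Eₙ⁻¹(L), this shows
-- both that L or its complement belongs to w(u₁,…,uₙ) and that this
-- choice does not change in a neighbourhood of (w , u).
--
-- Compactness of ℬ⋆ is the ultrafilter lemma.  Excluded middle is available
-- for all types, not only for propositions, so it provides witnesses and acts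
-- as a choice principle; the ultrafilter lemma then follows from Zorn's lemma,
-- obtained from the Bourbaki–Witt tower construction.
--
-- The principal ultrafilter of op w ts is w applied to those of the ts, so the
-- subalgebra generated by X consists of the principal ultrafilters of terms,
-- and these are dense because members of ultrafilters are inhabited.

open import Defs
open import Axiom.ExcludedMiddle using (ExcludedMiddle)
open import Axiom.Extensionality.Propositional using (Extensionality)
open import Data.Bool.Base using (Bool; true; false)
open import Data.Empty using (⊥-elim)
open import Data.Fin.Base using (Fin)
open import Data.List.Base using (List; []; _∷_; _++_)
open import Data.List.Relation.Unary.All as All using (All; []; _∷_)
open import Data.List.Relation.Unary.All.Properties using (++⁺; ++⁻)
open import Data.List.Relation.Unary.Any using (Any; here; there)
open import Data.Product.Base using (Σ-syntax; ∃; ∃₂; _×_; _,_; proj₁; proj₂)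
open import Data.Sum.Base as Sum using (_⊎_; inj₁; inj₂; [_,_]′)
open import Data.Unit.Polymorphic using (tt)
open import Function.Base using (id; _∘_)
open import Level using (Level; Lift; lift; lower; suc; _⊔_)
open import Relation.Binary.Bundles using (Setoid)
open import Relation.Binary.PropositionalEquality.Core using (_≡_; refl)
open import Relation.Nullary.Decidable.Core using (yes; no; does)
open import Relation.Nullary.Negation.Core using (¬_; contradiction)
open import Relation.Unary using (Pred; _∈_; _⊆_; ∁; _∩_; _∪_; _⟨×⟩_; _⊢_)

private
  variable
    a b ℓ : Level

-- Subsets are Bool-valued here so that, by extensionality, subsets with the
-- same elements are equal; the tower argument needs its step function to
-- respect equality of subsets.
Subset : Set a → Set a
Subset A = A → Bool

module _ {A : Set a} where

  ⟦_⟧ : Subset A → Pred A _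
  ⟦ S ⟧ x = S x ≡ true

  infix 4 _⊑_
  _⊑_ : Subset A → Subset A → Set a
  S ⊑ R = ∀ x → x ∈ ⟦ S ⟧ → x ∈ ⟦ R ⟧

  Chain : Pred (Subset A) ℓ → Set (a ⊔ ℓ)
  Chain 𝒞 = ∀ {S R} → S ∈ 𝒞 → R ∈ 𝒞 → S ⊑ R ⊎ R ⊑ S

-- Lists match the finite subcovers in `Compact`. The case `Ls = []` says that `T` is inhabited.
FIP : {T : Set a} → Pred (Pred T a) ℓ → Set (suc a ⊔ ℓ)
FIP 𝒢 = ∀ Ls → All (_∈ 𝒢) Ls → ∃ λ t → All (t ∈_) Ls

module Classical (em : ∀ {ℓ} → ExcludedMiddle ℓ) where

  -- Classical logic, resizing and comprehension.

  ¬¬-elim : {P : Set ℓ} → ¬ ¬ P → P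
  ¬¬-elim {P = P} ¬¬p with em {P = P}
  ... | yes p = p
  ... | no ¬p = contradiction ¬p ¬¬p

  all-or-any : {A : Set a} {P Q : Pred A b} → (∀ x → P x ⊎ Q x) → (∀ x → P x) ⊎ ∃ Q
  all-or-any {Q = Q} p∨q with em {P = ∃ Q}
  ... | yes ∃q = inj₂ ∃q
  ... | no ¬∃q = inj₁ λ x → [ id , (λ q → contradiction (x , q) ¬∃q) ]′ (p∨q x)

  -- Propositional resizing: excluded middle reduces a type to a Boolean, and a Boolean equation can
  -- be lifted to any universe.
  Resize : ∀ b → Set ℓ → Set b
  Resize b P = Lift b (does (em {P = P}) ≡ true)

  resize : {P : Set ℓ} → P → Resize b P
  resize {P = P} p with em {P = P}
  ... | yes _ = lift refl
  ... | no ¬p = contradiction p ¬p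

  unresize : {P : Set ℓ} → Resize b P → P
  unresize {P = P} (lift eq) with em {P = P} | eq
  ... | yes p | _  = p
  ... | no _  | ()

  module _ {A : Set a} where

    -- Comprehension is impredicative: `P` may live in any universe, yet the subset stays in
    -- `Subset A`. This is what lets `⋃` and `top` be formed.
    ⁅_⁆ : Pred A ℓ → Subset A
    ⁅ P ⁆ x = does (em {P = P x})

    intro : (P : Pred A ℓ) → ∀ {x} → x ∈ P → x ∈ ⟦ ⁅ P ⁆ ⟧
    intro P = lower {ℓ = a} ∘ resize

    elim : (P : Pred A ℓ) → ∀ {x} → x ∈ ⟦ ⁅ P ⁆ ⟧ → x ∈ P
    elim P = unresize {b = a} ∘ lift

    ⋃ : Subset (Subset A) → Subset A
    ⋃ 𝒞 = ⁅ (λ x → ∃ λ S → S ∈ ⟦ 𝒞 ⟧ × x ∈ ⟦ S ⟧) ⁆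

    ∈⋃⁻ : ∀ 𝒞 {x} → x ∈ ⟦ ⋃ 𝒞 ⟧ → ∃ λ S → S ∈ ⟦ 𝒞 ⟧ × x ∈ ⟦ S ⟧
    ∈⋃⁻ 𝒞 = elim (λ x → ∃ λ S → S ∈ ⟦ 𝒞 ⟧ × x ∈ ⟦ S ⟧)

    insert : A → Subset A → Subset A
    insert c S = ⁅ (λ x → x ∈ ⟦ S ⟧ ⊎ x ≡ c) ⁆

    ∈insert⁺ : ∀ c S {x} → x ∈ ⟦ S ⟧ ⊎ x ≡ c → x ∈ ⟦ insert c S ⟧
    ∈insert⁺ c S = intro (λ x → x ∈ ⟦ S ⟧ ⊎ x ≡ c)

    ∈insert⁻ : ∀ c S {x} → x ∈ ⟦ insert c S ⟧ → x ∈ ⟦ S ⟧ ⊎ x ≡ c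
    ∈insert⁻ c S = elim (λ x → x ∈ ⟦ S ⟧ ⊎ x ≡ c)

    ⋃-upper : ∀ {S} 𝒞 → S ∈ ⟦ 𝒞 ⟧ → S ⊑ ⋃ 𝒞
    ⋃-upper {S} 𝒞 S∈𝒞 x x∈S = intro (λ x → ∃ λ S → S ∈ ⟦ 𝒞 ⟧ × x ∈ ⟦ S ⟧) (S , S∈𝒞 , x∈S)

    ⋃-least : ∀ {R} 𝒞 → (∀ {S} → S ∈ ⟦ 𝒞 ⟧ → S ⊑ R) → ⋃ 𝒞 ⊑ R
    ⋃-least 𝒞 𝒞⊑R x x∈ with ∈⋃⁻ 𝒞 x∈
    ... | S , S∈𝒞 , x∈S = 𝒞⊑R S∈𝒞 x x∈S

  -- The Bourbaki-Witt tower of an inflationary map.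

  module Tower (ext : ∀ {ℓ ℓ′} → Extensionality ℓ ℓ′) {A : Set a}
               (f : Subset A → Subset A) (inflationary : ∀ S → S ⊑ f S) where

    ⊑-antisym : ∀ {S R : Subset A} → S ⊑ R → R ⊑ S → S ≡ R
    ⊑-antisym {S} {R} S⊑R R⊑S = ext λ x → iff (S x) (R x) (S⊑R x) (R⊑S x)
      where
      iff : ∀ p q → (p ≡ true → q ≡ true) → (q ≡ true → p ≡ true) → p ≡ q
      iff true  true  _ _ = refl
      iff false false _ _ = refl
      iff true  false g _ with () ← g refl
      iff false true  _ h with () ← h refl

    ⊑-trans : ∀ {S R Q : Subset A} → S ⊑ R → R ⊑ Q → S ⊑ Q
    ⊑-trans p q x = q x ∘ p x

    -- Unions of arbitrary families of stages are allowed; that stages form a chain is proved below.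
    -- The empty family gives the bottom stage.
    data Stage : Pred (Subset A) a where
      step : ∀ {S} → Stage S → Stage (f S)
      sup  : ∀ 𝒞 → (∀ {S} → S ∈ ⟦ 𝒞 ⟧ → Stage S) → Stage (⋃ 𝒞)

    Extremal : Pred (Subset A) a
    Extremal S = ∀ {R} → Stage R → R ⊑ S → ¬ S ⊑ R → f R ⊑ S

    -- Induction on the stage. In the step case with `R ⊑ S`, either `R` is strictly below `S` and
    -- extremality bounds `f R`, or `R` equals `S` and `f S ⊑ f R` is trivial.
    extremal-comparable : ∀ {S} → Extremal S → ∀ {R} → Stage R → R ⊑ S ⊎ f S ⊑ R
    extremal-comparable {S} S-ext (step {R} R∈) with extremal-comparable S-ext R∈
    ... | inj₂ fS⊑R = inj₂ (⊑-trans fS⊑R (inflationary R))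
    ... | inj₁ R⊑S with em {P = S ⊑ R}
    ...   | no S⋢R  = inj₁ (S-ext R∈ R⊑S S⋢R)
    ...   | yes S⊑R with refl ← ⊑-antisym R⊑S S⊑R = inj₂ λ _ → id
    extremal-comparable {S} S-ext (sup 𝒞 𝒞∈)
      with em {P = ∃ λ R → R ∈ ⟦ 𝒞 ⟧ × f S ⊑ R}
    ... | yes (R , R∈𝒞 , fS⊑R) = inj₂ (⊑-trans fS⊑R (⋃-upper 𝒞 R∈𝒞))
    ... | no ¬∃ = inj₁ (⋃-least 𝒞 λ R∈𝒞 →
      [ id , (λ fS⊑R → contradiction (_ , R∈𝒞 , fS⊑R) ¬∃) ]′
        (extremal-comparable S-ext (𝒞∈ R∈𝒞)))

    -- Induction on `S`. If `R` is strictly below a union, then `f S ⋢ R` for some member `S`, so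
    -- comparability with `S` places `R` below `S`.
    stage-extremal : ∀ {S} → Stage S → Extremal S
    stage-extremal (step {S} S∈) {R} R∈ R⊑fS fS⋢R
      with extremal-comparable (stage-extremal S∈) R∈
    ... | inj₂ fS⊑R = contradiction fS⊑R fS⋢R
    ... | inj₁ R⊑S with em {P = S ⊑ R}
    ...   | no S⋢R  = ⊑-trans (stage-extremal S∈ R∈ R⊑S S⋢R) (inflationary S)
    ...   | yes S⊑R with refl ← ⊑-antisym R⊑S S⊑R = λ _ → id
    stage-extremal (sup 𝒞 𝒞∈) {R} R∈ R⊑⋃ ⋃⋢R
      with em {P = ∃ λ S → S ∈ ⟦ 𝒞 ⟧ × ¬ f S ⊑ R}
    ... | no ¬∃ = contradiction
      (⋃-least 𝒞 λ {S} S∈𝒞 → ⊑-trans (inflationary S)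
        (¬¬-elim λ fS⋢R → ¬∃ (S , S∈𝒞 , fS⋢R)))
      ⋃⋢R
    ... | yes (S , S∈𝒞 , fS⋢R) with extremal-comparable (stage-extremal (𝒞∈ S∈𝒞)) R∈
    ...   | inj₂ fS⊑R = contradiction fS⊑R fS⋢R
    ...   | inj₁ R⊑S with em {P = S ⊑ R}
    ...     | no S⋢R  =
      ⊑-trans (stage-extremal (𝒞∈ S∈𝒞) R∈ R⊑S S⋢R) (⋃-upper 𝒞 S∈𝒞)
    -- Here `R` is `S` itself, so `S` is compared with the whole union: `⋃ 𝒞 ⊑ S` is excluded, which
    -- leaves `f S ⊑ ⋃ 𝒞`.
    ...     | yes S⊑R with refl ← ⊑-antisym R⊑S S⊑R =
      [ (λ ⋃⊑R → contradiction ⋃⊑R ⋃⋢R) , id ]′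
        (extremal-comparable (stage-extremal (𝒞∈ S∈𝒞)) (sup 𝒞 𝒞∈))

    stage-chain : Chain Stage
    stage-chain {S} {R} S∈ R∈ = [ inj₂ , inj₁ ∘ ⊑-trans (inflationary S) ]′
      (extremal-comparable (stage-extremal S∈) R∈)

    top : Subset A
    top = ⋃ ⁅ Stage ⁆

    -- By impredicativity the family of all stages is itself one of the families over which `sup`
    -- ranges.
    top-stage : Stage top
    top-stage = sup _ (elim Stage)

    top-fixed : f top ⊑ top
    top-fixed = ⋃-upper ⁅ Stage ⁆ (intro Stage (step top-stage))

  -- Zorn's lemma for families of subsets.

  module _ (ext : ∀ {ℓ ℓ′} → Extensionality ℓ ℓ′) {A : Set a} where

    -- The tower is run on the map that adds a new point preserving `P` whenever there is one; a
    -- fixed point of it is maximal. The hypothesis covers the empty chain, so it also gives `P` at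
    -- the bottom stage.
    zorn : (P : Pred (Subset A) ℓ) →
           (∀ 𝒞 → ⟦ 𝒞 ⟧ ⊆ P → Chain ⟦ 𝒞 ⟧ → P (⋃ 𝒞)) →
           ∃ λ M → P M × (∀ c → P (insert c M) → c ∈ ⟦ M ⟧)
    zorn P P-⋃ = top , P-stage top-stage , maximal
      where
      Extensible : Subset A → Set _
      Extensible S = ∃ λ c → ¬ c ∈ ⟦ S ⟧ × P (insert c S)

      extend : Subset A → Subset A
      extend S with em {P = Extensible S}
      ... | yes (c , _) = insert c S
      ... | no _        = S

      inflationary : ∀ S → S ⊑ extend S
      inflationary S x x∈S with em {P = Extensible S}
      ... | yes (c , _) = ∈insert⁺ c S (inj₁ x∈S)
      ... | no _        = x∈S

      open Tower ext extend inflationary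

      P-extend : ∀ S → P S → P (extend S)
      P-extend S PS with em {P = Extensible S}
      ... | yes (_ , _ , P-insert) = P-insert
      ... | no _                   = PS

      P-stage : ∀ {S} → Stage S → P S
      P-stage (step S∈)  = P-extend _ (P-stage S∈)
      P-stage (sup 𝒞 𝒞∈) = P-⋃ 𝒞 (λ S∈𝒞 → P-stage (𝒞∈ S∈𝒞))
        λ S∈𝒞 R∈𝒞 → stage-chain (𝒞∈ S∈𝒞) (𝒞∈ R∈𝒞)

      fixed⇒maximal : ∀ S → extend S ⊑ S → ¬ Extensible S
      fixed⇒maximal S fixed ∃c with em {P = Extensible S}
      ... | yes (c , c∉S , _) = c∉S (fixed c (∈insert⁺ c S (inj₂ refl)))
      ... | no ¬∃c            = ¬∃c ∃c

      maximal : ∀ c → P (insert c top) → c ∈ ⟦ top ⟧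
      maximal c Pc = ¬¬-elim λ c∉ → fixed⇒maximal top top-fixed (c , c∉ , Pc)

  -- The ultrafilter lemma.

  module _ {T : Set a} where

    FIP-anti : {𝒢 : Pred (Pred T a) ℓ} {ℋ : Pred (Pred T a) b} → 𝒢 ⊆ ℋ → FIP ℋ → FIP 𝒢
    FIP-anti 𝒢⊆ℋ fip Ls Ls∈𝒢 = fip Ls (All.map 𝒢⊆ℋ Ls∈𝒢)

    ¬FIP⇒∃ : {𝒢 : Pred (Pred T a) ℓ} → ¬ FIP 𝒢 →
             ∃ λ Ls → All (_∈ 𝒢) Ls × ¬ ∃ λ t → All (t ∈_) Ls
    ¬FIP⇒∃ ¬fip = ¬¬-elim λ ¬∃ → ¬fip λ Ls Ls∈𝒢 → ¬¬-elim λ none → ¬∃ (Ls , Ls∈𝒢 , none)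

    ultrafilter-lemma : (∀ {ℓ ℓ′} → Extensionality ℓ ℓ′) →
                        {𝒢 : Pred (Pred T a) ℓ} → FIP 𝒢 →
                        ∃ λ M → FIP ⟦ M ⟧ × 𝒢 ⊆ ⟦ M ⟧ × (∀ L → L ∈ ⟦ M ⟧ ⊎ ∁ L ∈ ⟦ M ⟧)
    ultrafilter-lemma ext {𝒢} 𝒢-fip = M , FIP-anti inj₁ M-fip , 𝒢⊆M , ultra
      where
      -- A finite list meets only finitely many members of the chain, so one of them contains all
      -- the entries that come from the union. A list drawn from `𝒢` alone is kept apart, since `𝒞`
      -- may be empty.
      FIP-⋃ : ∀ 𝒞 → (∀ {S} → S ∈ ⟦ 𝒞 ⟧ → FIP (⟦ S ⟧ ∪ 𝒢)) → Chain ⟦ 𝒞 ⟧ →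
              FIP (⟦ ⋃ 𝒞 ⟧ ∪ 𝒢)
      FIP-⋃ 𝒞 𝒞-fip chain Ls Ls∈ with gather Ls∈
        where
        gather : ∀ {Ls} → All (_∈ ⟦ ⋃ 𝒞 ⟧ ∪ 𝒢) Ls →
                 All (_∈ 𝒢) Ls ⊎ ∃ λ S → S ∈ ⟦ 𝒞 ⟧ × All (_∈ ⟦ S ⟧ ∪ 𝒢) Ls
        gather [] = inj₁ []
        gather (inj₂ L∈𝒢 ∷ Ls∈) with gather Ls∈
        ... | inj₁ Ls∈𝒢            = inj₁ (L∈𝒢 ∷ Ls∈𝒢)
        ... | inj₂ (S , S∈𝒞 , Ls∈S) = inj₂ (S , S∈𝒞 , inj₂ L∈𝒢 ∷ Ls∈S)
        gather (inj₁ L∈⋃ ∷ Ls∈)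
          with ∈⋃⁻ 𝒞 L∈⋃ | gather Ls∈
        ... | S , S∈𝒞 , L∈S | inj₁ Ls∈𝒢 = inj₂ (S , S∈𝒞 , inj₁ L∈S ∷ All.map inj₂ Ls∈𝒢)
        ... | S , S∈𝒞 , L∈S | inj₂ (R , R∈𝒞 , Ls∈R) with chain S∈𝒞 R∈𝒞
        ...   | inj₁ S⊑R = inj₂ (R , R∈𝒞 , inj₁ (S⊑R _ L∈S) ∷ Ls∈R)
        ...   | inj₂ R⊑S = inj₂ (S , S∈𝒞 , inj₁ L∈S ∷ All.map (Sum.map₁ (R⊑S _)) Ls∈R)
      ... | inj₁ Ls∈𝒢            = 𝒢-fip Ls Ls∈𝒢
      ... | inj₂ (S , S∈𝒞 , Ls∈S) = 𝒞-fip S∈𝒞 Ls Ls∈S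

      maximal-FIP = zorn ext (λ S → FIP (⟦ S ⟧ ∪ 𝒢)) FIP-⋃

      M : Subset (Pred T a)
      M = proj₁ maximal-FIP

      M-fip : FIP (⟦ M ⟧ ∪ 𝒢)
      M-fip = proj₁ (proj₂ maximal-FIP)

      maximal : ∀ L → FIP (⟦ insert L M ⟧ ∪ 𝒢) → L ∈ ⟦ M ⟧
      maximal = proj₂ (proj₂ maximal-FIP)

      𝒢⊆M : 𝒢 ⊆ ⟦ M ⟧
      𝒢⊆M L∈𝒢 = maximal _ (FIP-anti
        [ [ inj₁ , (λ { refl → inj₂ L∈𝒢 }) ]′ ∘ ∈insert⁻ _ M , inj₂ ]′ M-fip)

      -- Drops the occurrences of `L`. A failure of `FIP` after inserting `L` thus becomes a finite
      -- intersection of members of `M` and `𝒢` that misses `L`.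
      remove : ∀ L {Ns} → All (_∈ ⟦ insert L M ⟧ ∪ 𝒢) Ns →
               ∃ λ Ks → All (_∈ ⟦ M ⟧ ∪ 𝒢) Ks ×
                        (∀ {t} → t ∈ L → All (t ∈_) Ks → All (t ∈_) Ns)
      remove L [] = [] , [] , λ _ _ → []
      remove L (N∈ ∷ Ns∈) with remove L Ns∈ | Sum.map₁ (∈insert⁻ L M) N∈
      ... | Ks , Ks∈ , back | inj₁ (inj₂ refl) =
        Ks , Ks∈ , λ t∈L t∈Ks → t∈L ∷ back t∈L t∈Ks
      ... | Ks , Ks∈ , back | inj₁ (inj₁ N∈M) =
        _ ∷ Ks , inj₁ N∈M ∷ Ks∈ , λ { t∈L (t∈N ∷ t∈Ks) → t∈N ∷ back t∈L t∈Ks }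
      ... | Ks , Ks∈ , back | inj₂ N∈𝒢 =
        _ ∷ Ks , inj₂ N∈𝒢 ∷ Ks∈ , λ { t∈L (t∈N ∷ t∈Ks) → t∈N ∷ back t∈L t∈Ks }

      ultra : ∀ L → L ∈ ⟦ M ⟧ ⊎ ∁ L ∈ ⟦ M ⟧
      ultra L with em {P = FIP (⟦ insert L M ⟧ ∪ 𝒢)}
      ... | yes fip = inj₁ (maximal L fip)
      ... | no ¬fip with ¬FIP⇒∃ ¬fip
      ...   | Ls , Ls∈ , none with remove L Ls∈
      ...     | Ks , Ks∈ , back = inj₂ (maximal (∁ L) ∁L-fip)
        where
        ∁L-fip : FIP (⟦ insert (∁ L) M ⟧ ∪ 𝒢)
        ∁L-fip Ns Ns∈ with remove (∁ L) Ns∈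
        -- `Ks` has no common point in `L`, so any common point of `Ks` and `Ks′` lies in `∁ L`, as
        -- `back′` requires.
        ... | Ks′ , Ks′∈ , back′ with M-fip (Ks ++ Ks′) (++⁺ Ks∈ Ks′∈)
        ...   | t , t∈ with ++⁻ Ks t∈
        ...     | t∈Ks , t∈Ks′ = t , back′ (λ t∈L → none (t , back t∈L t∈Ks)) t∈Ks′

  -- The Stone dual: zero-dimensional, Hausdorff and compact.

  module Dual (ext : ∀ {ℓ ℓ′} → Extensionality ℓ ℓ′) {S : Setoid a a}
              (ℬ : Pred (Pred (Setoid.Carrier S) a) (suc a))
              (isBA : IsBooleanSubalgebra S ℬ) where
    private
      module ℬ = IsBooleanSubalgebra isBA
      module UF (u : Ultrafilter S ℬ) = IsUltrafilter (proj₂ u)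
    open Space (StoneDual ℬ isBA)

    member-inhabited : ∀ u {L} → L ∈ proj₁ u → ∃ L
    member-inhabited u L∈u = ¬¬-elim λ L-empty →
      UF.Empty∉ u (UF.upward u L∈u ℬ.Empty∈ λ t∈L → ⊥-elim (L-empty (_ , t∈L)))

    ultrafilter-disjoint : ∀ u {L} → L ∈ proj₁ u → ¬ ∁ L ∈ proj₁ u
    ultrafilter-disjoint u L∈u ∁L∈u with member-inhabited u (UF.∩-closed u L∈u ∁L∈u)
    ... | _ , t∈L , t∉L = t∉L t∈L

    -- Ultrafilters are maximal: if `L` were in `v` but not in `u`, then `∁ L` would be in `u`,
    -- hence in `v`.
    ultrafilter-⊆⇒≈ : ∀ {u v} → proj₁ u ⊆ proj₁ v → u ≈ v
    ultrafilter-⊆⇒≈ {u} {v} u⊆v = lift (u⊆v , λ L∈v →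
      [ id , (λ ∁L∈u → contradiction (u⊆v ∁L∈u) (ultrafilter-disjoint v L∈v)) ]′
        (UF.ultra u (UF.⊆ℬ v L∈v)))

    -- Defined at all points, since density uses every term; at `var x` the family unfolds to
    -- `principal`.
    pointFilter : Setoid.Carrier S → Ultrafilter S ℬ
    pointFilter t = (λ L → L ∈ ℬ × t ∈ L) , record
      { ⊆ℬ       = proj₁
      ; Full∈    = ℬ.Full∈ , tt
      ; Empty∉   = λ ()
      ; upward   = λ (_ , t∈L) M∈ℬ L⊆M → M∈ℬ , L⊆M t∈L
      ; ∩-closed = λ (L∈ℬ , t∈L) (M∈ℬ , t∈M) → ℬ.∩-closed L∈ℬ M∈ℬ , t∈L , t∈M
      ; ultra    = ultra
      }
      where
      ultra : ∀ {L} → L ∈ ℬ → (L ∈ ℬ × t ∈ L) ⊎ (∁ L ∈ ℬ × ¬ t ∈ L)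
      ultra {L} L∈ℬ with em {P = t ∈ L}
      ... | yes t∈L = inj₁ (L∈ℬ , t∈L)
      ... | no t∉L  = inj₂ (ℬ.∁-closed L∈ℬ , t∉L)

    restrict : (M : Subset (Pred (Setoid.Carrier S) a)) → FIP ⟦ M ⟧ →
               (∀ L → L ∈ ⟦ M ⟧ ⊎ ∁ L ∈ ⟦ M ⟧) → Ultrafilter S ℬ
    restrict M M-fip M-ultra = (λ L → L ∈ ℬ × L ∈ ⟦ M ⟧) , record
      { ⊆ℬ       = proj₁
      ; Full∈    = ℬ.Full∈ , large [] λ _ → tt
      ; Empty∉   = λ (_ , Empty∈M) → Empty-uninhabited (M-fip (Empty ∷ []) (Empty∈M ∷ []))
      ; upward   = λ (_ , L∈M) N∈ℬ L⊆N → N∈ℬ , large (L∈M ∷ []) λ { (t∈L ∷ []) → L⊆N t∈L }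
      ; ∩-closed = λ (L∈ℬ , L∈M) (N∈ℬ , N∈M) → ℬ.∩-closed L∈ℬ N∈ℬ ,
          large (L∈M ∷ N∈M ∷ []) λ { (t∈L ∷ t∈N ∷ []) → t∈L , t∈N }
      ; ultra    = λ {L} L∈ℬ → Sum.map (L∈ℬ ,_) (ℬ.∁-closed L∈ℬ ,_) (M-ultra L)
      }
      where
      Empty-uninhabited : ¬ ∃ λ t → All (t ∈_) (Empty ∷ [])
      Empty-uninhabited (_ , () ∷ _)

      -- Otherwise `∁ N` is in `M`, and adding it to `Ls` contradicts the finite intersection
      -- property.
      large : ∀ {Ls N} → All (_∈ ⟦ M ⟧) Ls → (∀ {t} → All (t ∈_) Ls → t ∈ N) → N ∈ ⟦ M ⟧
      large {Ls} {N} Ls∈M ⋂Ls⊆N with M-ultra N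
      ... | inj₁ N∈M  = N∈M
      ... | inj₂ ∁N∈M with M-fip (∁ N ∷ Ls) (∁N∈M ∷ Ls∈M)
      ...   | t , t∉N ∷ t∈Ls = contradiction (⋂Ls⊆N t∈Ls) t∉N

    -- Lift: membership in an ultrafilter lives one universe below open sets.
    basic : Pred (Setoid.Carrier S) a → Pred Carrier (suc (suc a))
    basic L u = Lift (suc (suc a)) (L ∈ proj₁ u)

    basic-open : ∀ {L} → L ∈ ℬ → Open (basic L)
    basic-open {L} L∈ℬ L∈u = basic L , (L , L∈ℬ , lower , lift) , L∈u , id

    basic-clopen : ∀ {L} → L ∈ ℬ → Clopen (basic L)
    basic-clopen {L} L∈ℬ = basic-open L∈ℬ , λ {u} L∉u →
      basic (∁ L) , (∁ L , ℬ.∁-closed L∈ℬ , lower , lift) ,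
      lift ([ (λ L∈u → contradiction (lift L∈u) L∉u) , id ]′ (UF.ultra u L∈ℬ)) ,
      λ {v} ∁L∈v L∈v → ultrafilter-disjoint v (lower L∈v) (lower ∁L∈v)

    open-basic : ∀ {W} → Open W → ∀ {u} → u ∈ W →
                 ∃ λ L → L ∈ ℬ × L ∈ proj₁ u × (∀ {v} → L ∈ proj₁ v → v ∈ W)
    open-basic W-open u∈W with W-open u∈W
    ... | V , (L , L∈ℬ , V⊆ , ⊆V) , u∈V , V⊆W = L , L∈ℬ , V⊆ u∈V , λ L∈v → V⊆W (⊆V L∈v)

    zeroDimensional : ZeroDimensional (StoneDual ℬ isBA)
    zeroDimensional W-open u∈W with open-basic W-open u∈W
    ... | L , L∈ℬ , L∈u , L⊆W = basic L , basic-clopen L∈ℬ , lift L∈u , λ L∈v → L⊆W (lower L∈v)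

    hausdorff : Hausdorff (StoneDual ℬ isBA)
    hausdorff u v u≉v with em {P = ∃ λ L → L ∈ proj₁ u × ∁ L ∈ proj₁ v}
    ... | yes (L , L∈u , ∁L∈v) =
      basic L , basic (∁ L) , basic-open (UF.⊆ℬ u L∈u) , basic-open (UF.⊆ℬ v ∁L∈v) ,
      lift L∈u , lift ∁L∈v ,
      λ {w} (L∈w , ∁L∈w) → ultrafilter-disjoint w (lower L∈w) (lower ∁L∈w)
    ... | no ¬∃ = contradiction
      (ultrafilter-⊆⇒≈ {u} {v} λ L∈u →
        [ id , (λ ∁L∈v → contradiction (_ , L∈u , ∁L∈v) ¬∃) ]′ (UF.ultra v (UF.⊆ℬ u L∈u)))
      u≉v

    module _ (𝒰 : Pred (Pred Carrier (suc (suc a))) (suc (suc (suc a)))) where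

      -- Complements of the members of `ℬ` whose basic open set fits inside one member of the cover.
      -- That member is recorded so that a finite subcover can be read off.
      CoComponent : Pred (Pred (Setoid.Carrier S) a) (suc (suc (suc a)))
      CoComponent N = ∃₂ λ L U → L ∈ ℬ × U ∈ 𝒰 × N ≡ ∁ L × (∀ {u} → L ∈ proj₁ u → u ∈ U)

      -- An ultrafilter containing all these complements restricts to a point of the dual. The cover
      -- provides some `L` in it whose complement is also in it.
      cover⇒¬FIP : 𝒰 ⊆ Open → (∀ u → u ∈ Union 𝒰) → ¬ FIP CoComponent
      cover⇒¬FIP 𝒰⊆Open cover fip with ultrafilter-lemma ext fip
      ... | M , M-fip , ⊆M , M-ultra with cover (restrict M M-fip M-ultra)
      ...   | U , U∈𝒰 , u∈U with open-basic (𝒰⊆Open U∈𝒰) u∈U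
      ...     | L , L∈ℬ , (_ , L∈M) , L⊆U
        with M-fip (L ∷ ∁ L ∷ []) (L∈M ∷ ⊆M (L , U , L∈ℬ , U∈𝒰 , refl , λ {u} → L⊆U {u}) ∷ [])
      ...       | _ , t∈L ∷ t∉L ∷ [] = t∉L t∈L

      -- A point outside all the chosen `Us` contains every complement in the list, hence also their
      -- intersection `K`. When `Ns` has no common point, `K` is empty, which `compact` refutes.
      components : ∀ {Ns} → All CoComponent Ns →
        Σ[ Us ∈ List (Pred Carrier (suc (suc a))) ] All (_∈ 𝒰) Us ×
          (∀ u → Any (u ∈_) Us ⊎ ∃ λ K → K ∈ proj₁ u × (∀ {t} → t ∈ K → All (t ∈_) Ns))
      components [] = [] , [] , λ u → inj₂ (Full , UF.Full∈ u , λ _ → [])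
      components ((L , U , L∈ℬ , U∈𝒰 , refl , L⊆U) ∷ Ns∈) with components Ns∈
      ... | Us , Us∈𝒰 , split = U ∷ Us , U∈𝒰 ∷ Us∈𝒰 , split′
        where
        split′ : ∀ u → Any (u ∈_) (U ∷ Us) ⊎
                 ∃ λ K → K ∈ proj₁ u × (∀ {t} → t ∈ K → All (t ∈_) (∁ L ∷ _))
        split′ u with UF.ultra u L∈ℬ | split u
        ... | inj₁ L∈u  | _          = inj₁ (here (L⊆U {u} L∈u))
        ... | inj₂ _    | inj₁ u∈Us  = inj₁ (there u∈Us)
        ... | inj₂ ∁L∈u | inj₂ (K , K∈u , K⊆) =
          inj₂ (∁ L ∩ K , UF.∩-closed u ∁L∈u K∈u , λ (t∉L , t∈K) → t∉L ∷ K⊆ t∈K)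

    compact : Compact (StoneDual ℬ isBA)
    compact 𝒰 𝒰⊆Open cover =
      let Ns , Ns∈ , none    = ¬FIP⇒∃ (cover⇒¬FIP 𝒰 𝒰⊆Open cover)
          Us , Us∈𝒰 , split = components 𝒰 Ns∈
      in Us , Us∈𝒰 , λ u →
        [ id , (λ (K , K∈u , K⊆) →
                  let t , t∈K = member-inhabited u K∈u in
                  contradiction (t , K⊆ t∈K) none) ]′ (split u)

  -- Operations on ultrafilters and their continuity.

  module Operations (ext : ∀ {ℓ ℓ′} → Extensionality ℓ ℓ′) {a : Level}
                    (Ω : TopologicalSignature a) (X : Space a)
                    (ℬ : Pred (Pred (Term Ω X) a) (suc a))
                    (isBA : IsBooleanSubalgebra (Term-setoid Ω X) ℬ)
                    (∗ : Condition-∗ Ω X ℬ) where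
    private
      module Ω n = Space (Ω n)
      module X = Space X
      module T = Setoid (Term-setoid Ω X)
      module ℬ = IsBooleanSubalgebra isBA
      module UF (u : Ultrafilter (Term-setoid Ω X) ℬ) = IsUltrafilter (proj₂ u)
    open Dual ext ℬ isBA

    Point : Set (suc (suc a))
    Point = Ultrafilter (Term-setoid Ω X) ℬ

    -- `K` and `Ls` describe a neighbourhood of `(w , u)` in the dual, while the box that they span,
    -- like `W`, consists of tuples of terms.
    ConstantNear : ∀ {n} → Ω.Carrier n → (Fin n → Point) →
                   Pred (Pred (Space.Carrier (Dom Ω (TermAlgebra Ω X) n)) a) (suc a)
    ConstantNear {n} w u W =
      ∃₂ λ (K : Pred (Ω.Carrier n) a) (Ls : Fin n → Pred (Term Ω X) a) →
        Ω.Open n K × w ∈ K × (∀ i → Ls i ∈ proj₁ (u i)) ×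
        ((K ⟨×⟩ Box Ls) ⊆ W ⊎ (K ⟨×⟩ Box Ls) ⊆ ∁ W)

    module _ {n} (w : Ω.Carrier n) (u : Fin n → Point) where

      -- Both witnesses survive shrinking to the common box, so a binary Boolean operation only has
      -- to say how the two alternatives combine.
      constantNear-map₂ : ∀ {W V Z} →
        (∀ {A : Pred (Space.Carrier (Dom Ω (TermAlgebra Ω X) n)) a} →
           A ⊆ W ⊎ A ⊆ ∁ W → A ⊆ V ⊎ A ⊆ ∁ V → A ⊆ Z ⊎ A ⊆ ∁ Z) →
        ConstantNear w u W → ConstantNear w u V → ConstantNear w u Z
      constantNear-map₂ f (K , Ls , oK , w∈K , Ls∈u , c) (K′ , Ls′ , oK′ , w∈K′ , Ls′∈u , c′) =
        K ∩ K′ , (λ i → Ls i ∩ Ls′ i) , Ω.Open-∩ n oK oK′ , (w∈K , w∈K′) ,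
        (λ i → UF.∩-closed (u i) (Ls∈u i) (Ls′∈u i)) ,
        f (Sum.map left left c) (Sum.map right right c′)
        where
        left : ∀ {V : Pred (Space.Carrier (Dom Ω (TermAlgebra Ω X) n)) a} →
               (K ⟨×⟩ Box Ls) ⊆ V → ((K ∩ K′) ⟨×⟩ Box (λ i → Ls i ∩ Ls′ i)) ⊆ V
        left sub ((v∈K , _) , ts∈) = sub (v∈K , proj₁ ∘ ts∈)

        right : ∀ {V : Pred (Space.Carrier (Dom Ω (TermAlgebra Ω X) n)) a} →
                (K′ ⟨×⟩ Box Ls′) ⊆ V → ((K ∩ K′) ⟨×⟩ Box (λ i → Ls i ∩ Ls′ i)) ⊆ V
        right sub ((_ , v∈K′) , ts∈) = sub (v∈K′ , proj₂ ∘ ts∈)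

      ultrafilter-decides : ∀ i {L} → L ∈ ℬ → ∃ λ N → N ∈ proj₁ (u i) × (N ⊆ L ⊎ N ⊆ ∁ L)
      ultrafilter-decides i {L} L∈ℬ with UF.ultra (u i) L∈ℬ
      ... | inj₁ L∈u  = L   , L∈u  , inj₁ id
      ... | inj₂ ∁L∈u = ∁ L , ∁L∈u , inj₂ id

      clopen-decides : ∀ {K} → Ω.Clopen n K → ∃ λ N → Ω.Open n N × w ∈ N × (N ⊆ K ⊎ N ⊆ ∁ K)
      clopen-decides {K} (oK , o∁K) with em {P = w ∈ K}
      ... | yes w∈K = K   , oK  , w∈K , inj₁ id
      ... | no w∉K  = ∁ K , o∁K , w∉K , inj₂ id

      product-constantNear : ∀ {W} → W ∈ Product Ω X ℬ n → ConstantNear w u W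
      product-constantNear {W} (K , L , clopen , L∈ℬ , W⊆ , ⊆W) =
        proj₁ dK , (λ i → proj₁ (dL i)) , proj₁ (proj₂ dK) , proj₁ (proj₂ (proj₂ dK)) ,
        (λ i → proj₁ (proj₂ (dL i))) ,
        -- One coordinate inside the complement of its `L i` already expels the whole box from `W`;
        -- otherwise all coordinates lie inside.
        side (proj₂ (proj₂ (proj₂ dK))) (all-or-any (λ i → proj₂ (proj₂ (dL i))))
        where
        dK = clopen-decides clopen
        dL = λ i → ultrafilter-decides i (L∈ℬ i)

        side : ∀ {N : Pred (Ω.Carrier n) a} {Ls : Fin n → Pred (Term Ω X) a} →
               N ⊆ K ⊎ N ⊆ ∁ K → (∀ i → Ls i ⊆ L i) ⊎ ∃ (λ i → Ls i ⊆ ∁ (L i)) →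
               (N ⟨×⟩ Box Ls) ⊆ W ⊎ (N ⟨×⟩ Box Ls) ⊆ ∁ W
        side (inj₂ N⊆∁K) _ = inj₂ λ (v∈N , _) p → N⊆∁K v∈N (proj₁ (W⊆ p))
        side (inj₁ _) (inj₂ (i , Lᵢ⊆∁)) = inj₂ λ (_ , ts∈) p → Lᵢ⊆∁ (ts∈ i) (proj₂ (W⊆ p) i)
        side (inj₁ N⊆K) (inj₁ Ls⊆L) = inj₁ λ (v∈N , ts∈) → ⊆W (N⊆K v∈N , λ i → Ls⊆L i (ts∈ i))

      constantNear : ∀ {W} → W ∈ ℬ′ Ω X ℬ n → ConstantNear w u W
      constantNear (generator W∈) = product-constantNear W∈
      constantNear (same (L⊆M , M⊆L) W∈) with constantNear W∈
      ... | K , Ls , oK , w∈K , Ls∈u , c = K , Ls , oK , w∈K , Ls∈u ,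
        Sum.map (λ sub p → L⊆M (sub p)) (λ sub p q → sub p (M⊆L q)) c
      constantNear empty =
        Full , (λ _ → Full) , Ω.Open-Full n , tt , (λ i → UF.Full∈ (u i)) , inj₂ λ _ ()
      constantNear full =
        Full , (λ _ → Full) , Ω.Open-Full n , tt , (λ i → UF.Full∈ (u i)) , inj₁ λ _ → tt
      constantNear (compl W∈) with constantNear W∈
      ... | K , Ls , oK , w∈K , Ls∈u , c = K , Ls , oK , w∈K , Ls∈u ,
        Sum.swap (Sum.map₁ (λ sub p q → q (sub p)) c)
      constantNear (inter W∈ V∈) = constantNear-map₂
        (λ { (inj₁ p) (inj₁ q) → inj₁ λ x → p x , q x
           ; (inj₂ p) _        → inj₂ λ x (y , _) → p x y
           ; (inj₁ _) (inj₂ q) → inj₂ λ x (_ , y) → q x y })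
        (constantNear W∈) (constantNear V∈)
      constantNear (union W∈ V∈) = constantNear-map₂
        (λ { (inj₁ p) _        → inj₁ λ x → inj₁ (p x)
           ; (inj₂ _) (inj₁ q) → inj₁ λ x → inj₂ (q x)
           ; (inj₂ p) (inj₂ q) → inj₂ λ x → [ p x , q x ]′ })
        (constantNear W∈) (constantNear V∈)

    apply⁺ : ∀ {n} {w : Ω.Carrier n} (u : Fin n → Point) {Ls L} → L ∈ ℬ →
             (∀ i → Ls i ∈ proj₁ (u i)) → (∀ {ts} → ts ∈ Box Ls → op w ts ∈ L) →
             L ∈ apply Ω X ℬ w u
    apply⁺ u L∈ℬ Ls∈u sub =
      L∈ℬ , _ , Ls∈u , λ (ts , ts∈ , t≈) → ℬ.subset L∈ℬ (T.sym t≈) (sub ts∈)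

    apply-isUltrafilter : ∀ n (w : Ω.Carrier n) u →
                          IsUltrafilter (Term-setoid Ω X) ℬ (apply Ω X ℬ w u)
    apply-isUltrafilter n w u = record
      { ⊆ℬ       = proj₁
      ; Full∈    = ℬ.Full∈ , (λ _ → Full) , (λ i → UF.Full∈ (u i)) , λ _ → tt
      ; Empty∉   = λ (_ , Ls , Ls∈u , sub) →
          let t = λ i → member-inhabited (u i) (Ls∈u i) in
          lower (sub (proj₁ ∘ t , proj₂ ∘ t , T.refl))
      ; upward   = λ (_ , Ls , Ls∈u , sub) M∈ℬ L⊆M → M∈ℬ , Ls , Ls∈u , λ p → L⊆M (sub p)
      ; ∩-closed = λ (L∈ℬ , Ls , Ls∈u , sub) (M∈ℬ , Ms , Ms∈u , sub′) →
          ℬ.∩-closed L∈ℬ M∈ℬ , (λ i → Ls i ∩ Ms i) ,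
          (λ i → UF.∩-closed (u i) (Ls∈u i) (Ms∈u i)) ,
          λ (ts , ts∈ , t≈) → sub (ts , proj₁ ∘ ts∈ , t≈) , sub′ (ts , proj₂ ∘ ts∈ , t≈)
      ; ultra    = ultra
      }
      where
      ultra : ∀ {L} → L ∈ ℬ → L ∈ apply Ω X ℬ w u ⊎ ∁ L ∈ apply Ω X ℬ w u
      -- The slice of the box over `w` decides `L`; the other points of `K` enter in
      -- `E-preimage-open`.
      ultra L∈ℬ with constantNear w u (∗ n L∈ℬ)
      ... | K , Ls , _ , w∈K , Ls∈u , inj₁ sub =
        inj₁ (apply⁺ u L∈ℬ Ls∈u λ ts∈ → sub (w∈K , ts∈))
      ... | K , Ls , _ , w∈K , Ls∈u , inj₂ sub =
        inj₂ (apply⁺ u (ℬ.∁-closed L∈ℬ) Ls∈u λ ts∈ → sub (w∈K , ts∈))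

    E : Evaluation Ω (StoneDual ℬ isBA)
    E n (w , u) = apply Ω X ℬ w u , apply-isUltrafilter n w u

    E-preimage-open : ∀ n {V} → Space.Open (StoneDual ℬ isBA) V →
                      Space.Open (Dom Ω (StoneDual ℬ isBA) n) (E n ⊢ V)
    E-preimage-open n V-open {w , u} p with open-basic V-open p
    ... | L , L∈ℬ , L∈Ewu , L⊆V with constantNear w u (∗ n L∈ℬ)
    -- This alternative would put `∁ L` into the value at `(w , u)`, which already contains `L`.
    ...   | K , Ls , K-open , w∈K , Ls∈u , inj₂ sub = contradiction
      (apply⁺ u (ℬ.∁-closed L∈ℬ) Ls∈u λ ts∈ → sub (w∈K , ts∈))
      (ultrafilter-disjoint (E n (w , u)) L∈Ewu)
    ...   | K , Ls , K-open , w∈K , Ls∈u , inj₁ sub =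
      -- The same `K` and `Ls` witness `L` in the value at every point of this neighbourhood.
      (K ⟨×⟩ Box (basic ∘ Ls)) ,
      (K , Box (basic ∘ Ls) , K-open , box-open , id , id) ,
      (w∈K , λ i → lift (Ls∈u i)) ,
      λ {(_ , v)} (v∈K , Ls∈v) → L⊆V (apply⁺ v L∈ℬ (λ i → lower (Ls∈v i)) λ ts∈ → sub (v∈K , ts∈))
      where
      box-open : Space.Open (StoneDual ℬ isBA ^ₛ n) (Box (basic ∘ Ls))
      box-open q = Box (basic ∘ Ls) ,
        ((basic ∘ Ls) , (λ i → basic-open (UF.⊆ℬ (u i) (Ls∈u i))) , id , id) , q , id

    E-continuous : ∀ n → Continuous (Dom Ω (StoneDual ℬ isBA) n) (StoneDual ℬ isBA) (E n)
    E-continuous n = record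
      { cong     = λ {x} {y} (w≈v , us≈vs) → ultrafilter-⊆⇒≈ {E n x} {E n y}
          λ (L∈ℬ , Ls , Ls∈u , sub) → L∈ℬ , Ls , (λ i → proj₁ (lower (us≈vs i)) (Ls∈u i)) ,
            λ (ts , ts∈ , t≈) →
              sub (ts , ts∈ , T.trans t≈ (op (Setoid.sym (Ω.setoid n) w≈v) (λ _ → T.refl)))
      ; preimage = λ {V} V-open → (E n ⊢ V) , E-preimage-open n V-open , id , id
      }

    isStoneTopologicalAlgebra : IsStoneTopologicalAlgebra Ω (StoneDual ℬ isBA) E
    isStoneTopologicalAlgebra = record
      { compact         = compact
      ; hausdorff       = hausdorff
      ; zeroDimensional = zeroDimensional
      ; continuous      = E-continuous
      }

    -- The generating mapping.

    η : X.Carrier → Point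
    η x = pointFilter (var x)

    η-cong : ∀ {x y} → x X.≈ y → Space._≈_ (StoneDual ℬ isBA) (η x) (η y)
    η-cong {x} {y} x≈y = ultrafilter-⊆⇒≈ {η x} {η y} λ (L∈ℬ , x∈L) →
      L∈ℬ , ℬ.subset L∈ℬ (var x≈y) x∈L

    η-continuous : (∀ {L} → L ∈ ℬ → X.Open (var ⊢ L)) → Continuous X (StoneDual ℬ isBA) η
    η-continuous traces-open = record { cong = η-cong ; preimage = preimage }
      where
      preimage : ∀ {V} → Space.Open (StoneDual ℬ isBA) V → X.IsOpen (η ⊢ V)
      preimage {V} V-open = W , W-open , unresize , resize
        where
        -- `η ⊢ V` lives in a larger universe than the open sets of `X`, so it is resized and then
        -- written as the union of the open sets inside it.
        W : Pred X.Carrier a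
        W x = Resize a (η x ∈ V)

        W-open : X.Open W
        W-open = X.Open-⋃ (λ P → X.Open P × P ⊆ W) proj₁ (W⊆ , λ (_ , (_ , P⊆W) , x∈P) → P⊆W x∈P)
          where
          W⊆ : W ⊆ Union (λ P → X.Open P × P ⊆ W)
          W⊆ x∈W with open-basic V-open (unresize x∈W)
          ... | L , L∈ℬ , (_ , x∈L) , L⊆V =
            var ⊢ L , (traces-open L∈ℬ , λ y∈L → resize (L⊆V (L∈ℬ , y∈L))) , x∈L

    Generated : Pred Point (suc (suc a))
    Generated = Subalgebra Ω (StoneDual ℬ isBA) E
                  (λ u → ∃ λ x → Space._≈_ (StoneDual ℬ isBA) u (η x))

    -- Induction on the term. By maximality one inclusion suffices for `op`: if the `Ls` contain the
    -- `ts`, then `op w ts` lies in their image, hence in `L`.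
    pointFilter-generated : ∀ t → pointFilter t ∈ Generated
    pointFilter-generated (var x) = generator (x , η-cong {x} {x} (Setoid.refl X.setoid))
    pointFilter-generated (op {n} w ts) = resp-≈
      (ultrafilter-⊆⇒≈ {E n (w , pointFilter ∘ ts)} {pointFilter (op w ts)}
        λ (L∈ℬ , Ls , ts∈Ls , sub) → L∈ℬ , sub (ts , (λ i → proj₂ (ts∈Ls i)) , T.refl))
      (closed w (pointFilter ∘ ts) (λ i → pointFilter-generated (ts i)))

    generated-dense : Dense (StoneDual ℬ isBA) Generated
    generated-dense W-open {u} u∈W with open-basic W-open u∈W
    ... | L , L∈ℬ , L∈u , L⊆W with member-inhabited u L∈u
    ...   | t , t∈L = pointFilter t , pointFilter-generated t , L⊆W (L∈ℬ , t∈L)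

theorem5p5 : (∀ {ℓ} → ExcludedMiddle ℓ) →
    (∀ {ℓ ℓ′} → Extensionality ℓ ℓ′) →
    ∀ {a : Level} (Ω : TopologicalSignature a) (X : Space a)
    (ℬ : Pred (Pred (Term Ω X) a) (suc a))
    (isBA : IsBooleanSubalgebra (Term-setoid Ω X) ℬ) →
    Condition-∗ Ω X ℬ →
    Σ[ isUF ∈ (∀ n w (u : Fin n → Ultrafilter (Term-setoid Ω X) ℬ) → IsUltrafilter (Term-setoid Ω X) ℬ (apply Ω X ℬ w u)) ]
    let E : Evaluation Ω (StoneDual ℬ isBA)
        E = λ n (w , u) → apply Ω X ℬ w u , isUF n w u
    in
    IsStoneTopologicalAlgebra Ω (StoneDual ℬ isBA) E
    × ((∀ {L} → L ∈ ℬ → Space.Open X (var ⊢ L)) →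
       Σ[ isUFₓ ∈ (∀ x → IsUltrafilter (Term-setoid Ω X) ℬ (principal Ω X ℬ x)) ]
       IsGeneratingMapping Ω X (StoneDual ℬ isBA) E (λ x → principal Ω X ℬ x , isUFₓ x))
theorem5p5 em ext Ω X ℬ isBA ∗ =
  apply-isUltrafilter , isStoneTopologicalAlgebra ,
  λ traces-open → (λ x → proj₂ (η x)) ,
    record { continuous = η-continuous traces-open ; dense = generated-dense }
  where open Classical.Operations em ext Ω X ℬ isBA ∗
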